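{- Let the sequence $(b_0,b_1,\ldots)$ be defined by $b_0:=0$ and $b_k:=E_{2k-1}(1)/(2k-1)!$ for $k\ge1$, where $E_j(x)$ are the Euler polynomials. Then for all $n\ge1$, $$H_n(b_k)=(-1)^n\frac{(4n+2)!}{(2n-1)!}\cdot H_n\left(\frac{E_{2k+1}(1)}{(2k+1)!}\right).$$
   Context: For a sequence $(a_k)_{k\ge 0}$ and $n\ge 0$, $H_n(a_k):=\det(a_{i+j})_{0\le i,j\le n}$ denotes the $(n+1)\times(n+1)$ Hankel determinant; all sequences are indexed by $k\ge0$. The Euler polynomials are defined by $\frac{2e^{xt}}{e^t+1}=\sum_{n\ge0}E_n(x)\frac{t^n}{n!}$. -}

module Defs where

import Algebra.Definitions.RawSemiring
open import Data.Fin.Base using (Fin; zero; suc; toℕ; punchIn)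
import Data.Integer.Base as ℤ
open import Data.Nat.Base as ℕ using (ℕ; zero; suc; _!; _∸_)
open import Data.Nat.Properties using (_!≢0)
open import Data.Rational.Base
open import Data.Rational.Properties
open import Relation.Binary.PropositionalEquality

open Algebra.Definitions.RawSemiring +-*-rawSemiring public
  using (sum; _^_)

infixl 7 _/!_

fromℕ : ℕ → ℚ
fromℕ n = (ℤ.+ n) / 1

_/!_ : ℚ → ℕ → ℚ
q /! n = q * ((ℤ.+ 1) / (n !)) {{n !≢0}}

------------------------------------------------------------------------
-- Formal power series in t over ℚ, as coefficient sequences

Series : Set
Series = ℕ → ℚ

infixl 6 _⊕_
infixl 7 _⊛_ _⊘_ _·_

one : Series
one zero    = 1ℚ
one (suc _) = 0ℚ

_⊕_ : Series → Series → Series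
(f ⊕ g) n = f n + g n

_·_ : ℚ → Series → Series
(c · f) n = c * f n

_⊛_ : Series → Series → Series
(f ⊛ g) n = sum {suc n} λ i → f (toℕ i) * g (n ∸ toℕ i)

-- Long division: with c = f₀ / g₀, one has f / g = c + t · (((f - c g) / t) / g).
_⊘_ : (f g : Series) .{{_ : NonZero (g 0)}} → Series
(f ⊘ g) zero    = f 0 ÷ g 0
(f ⊘ g) (suc n) = ((λ k → f (suc k) - (f 0 ÷ g 0) * g (suc k)) ⊘ g) n

÷-*-cancel : ∀ p q .{{_ : NonZero q}} → (p ÷ q) * q ≡ p
÷-*-cancel p q = begin
  p * 1/ q * q    ≡⟨ *-assoc p (1/ q) q ⟩
  p * (1/ q * q)  ≡⟨ cong (p *_) (*-inverseˡ q) ⟩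
  p * 1ℚ          ≡⟨ *-identityʳ p ⟩
  p               ∎
  where open ≡-Reasoning

⊘-⊛-cancel : ∀ f g .{{_ : NonZero (g 0)}} n → ((f ⊘ g) ⊛ g) n ≡ f n
⊘-⊛-cancel f g zero    =
  trans (+-identityʳ ((f 0 ÷ g 0) * g 0)) (÷-*-cancel (f 0) (g 0))
⊘-⊛-cancel f g (suc n) = begin
  c * g (suc n) + ((f′ ⊘ g) ⊛ g) n
    ≡⟨ cong (c * g (suc n) +_) (⊘-⊛-cancel f′ g n) ⟩
  c * g (suc n) + (f (suc n) - c * g (suc n))
    ≡⟨ +-comm (c * g (suc n)) _ ⟩
  f (suc n) - c * g (suc n) + c * g (suc n)
    ≡⟨ +-assoc (f (suc n)) _ _ ⟩
  f (suc n) + (- (c * g (suc n)) + c * g (suc n))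
    ≡⟨ cong (f (suc n) +_) (+-inverseˡ (c * g (suc n))) ⟩
  f (suc n) + 0ℚ
    ≡⟨ +-identityʳ (f (suc n)) ⟩
  f (suc n) ∎
  where
  open ≡-Reasoning
  c : ℚ
  c = f 0 ÷ g 0
  f′ : Series
  f′ k = f (suc k) - c * g (suc k)

-- The exponential series e^{xt}.
exp : ℚ → Series
exp x n = x ^ n /! n

------------------------------------------------------------------------
-- Euler polynomials, through their values: E n x is n! times the
-- coefficient of tⁿ in 2e^{xt} / (e^t + 1).

E : ℕ → ℚ → ℚ
E n x = fromℕ (n !) * ((fromℕ 2 · exp x) ⊘ (exp 1ℚ ⊕ one)) n

private
  n!*[1/n!] : ∀ n → fromℕ (n !) * ((ℤ.+ 1) / (n !)) {{n !≢0}} ≡ 1ℚ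
  n!*[1/n!] n = lemma (n !) {{n !≢0}}
    where
    open import Data.Rational.Unnormalised.Base as ℚᵘ using (*≡*)
    import Data.Rational.Unnormalised.Properties as ℚᵘ
    import Data.Integer.Properties as ℤ
    lemma : ∀ m .{{_ : ℕ.NonZero m}} → fromℕ m * ((ℤ.+ 1) / m) ≡ 1ℚ
    lemma m@(suc k) = toℚᵘ-injective (ℚᵘ.≃-trans
      (toℚᵘ-homo-* (fromℕ m) ((ℤ.+ 1) / m)) (ℚᵘ.≃-trans
      (ℚᵘ.*-cong (toℚᵘ-fromℚᵘ (ℚᵘ.mkℚᵘ (ℤ.+ m) 0)) (toℚᵘ-fromℚᵘ (ℚᵘ.mkℚᵘ (ℤ.+ 1) k)))
      (*≡* (trans (ℤ.*-identityʳ _) (trans (ℤ.*-identityʳ (ℤ.+ m))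
        (sym (trans (ℤ.*-identityˡ _) (ℤ.*-identityˡ (ℤ.+ m)))))))))

E/!-coeff : ∀ x n → E n x /! n ≡ ((fromℕ 2 · exp x) ⊘ (exp 1ℚ ⊕ one)) n
E/!-coeff x n = begin
  fromℕ (n !) * q * r    ≡⟨ cong (_* r) (*-comm (fromℕ (n !)) q) ⟩
  q * fromℕ (n !) * r    ≡⟨ *-assoc q (fromℕ (n !)) r ⟩
  q * (fromℕ (n !) * r)  ≡⟨ cong (q *_) (n!*[1/n!] n) ⟩
  q * 1ℚ                 ≡⟨ *-identityʳ q ⟩
  q                      ∎
  where
  open ≡-Reasoning
  q r : ℚ
  q = ((fromℕ 2 · exp x) ⊘ (exp 1ℚ ⊕ one)) n
  r = ((ℤ.+ 1) / (n !)) {{n !≢0}}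

-- The defining identity (Σ E_n(x) tⁿ/n!) (e^t + 1) = 2e^{xt}.
E-generating : ∀ x n → ((λ k → E k x /! k) ⊛ (exp 1ℚ ⊕ one)) n ≡ (fromℕ 2 · exp x) n
E-generating x n = trans
  (sum-cong {suc n} λ i → cong (_* (exp 1ℚ ⊕ one) (n ∸ toℕ i)) (E/!-coeff x (toℕ i)))
  (⊘-⊛-cancel (fromℕ 2 · exp x) (exp 1ℚ ⊕ one) n)
  where
  open import Algebra.Properties.CommutativeMonoid.Sum +-0-commutativeMonoid
    renaming (sum-cong-≗ to sum-cong) using ()

------------------------------------------------------------------------
-- Determinants, by Laplace expansion along the first row

Matrix : ℕ → Set
Matrix n = Fin n → Fin n → ℚ

det : ∀ {n} → Matrix n → ℚ
det {zero}  A = 1ℚ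
det {suc n} A = sum λ j →
  (- 1ℚ) ^ toℕ j * A zero j * det (λ r c → A (suc r) (punchIn j c))

-- The matrix has size n + 1: rows and columns are indexed by 0, …, n.
H : ℕ → (ℕ → ℚ) → ℚ
H n a = det {suc n} λ i j → a (toℕ i ℕ.+ toℕ j)

------------------------------------------------------------------------

b : ℕ → ℚ
b zero      = 0ℚ
b k@(suc _) = E (2 ℕ.* k ∸ 1) 1ℚ /! (2 ℕ.* k ∸ 1)

{-# OPTIONS --safe #-}

-- Put T = tanh(t/2) = Σ aₖ t^{2k+1}, so that b has generating function t T in t².
-- The remainders of the continued fraction of T,
--   Y₀ = 1,  Y₁ = t T,  Y_{N+2} = t² Y_N − (4N + 2) Y_{N+1},
-- satisfy Y_N = O(t^{2N}), because (e^t + 1) Y_N has an explicit expansion.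
-- As Y_N is a polynomial combination of 1 and t T, this yields vectors v for
-- which Σᵢ vᵢ a_{i+j} or Σᵢ vᵢ b_{i+j} vanishes for all j ≤ m but not for j = m + 1.
-- Replacing the last row of the Hankel matrix of size m + 2 by that combination
-- of the rows expresses H_{m+1} as a multiple of H_m, both for a and for b, and
-- the ratio of the two factors is the ratio of consecutive values of the claimed
-- constant. For b the combination takes Y_{2m+3} and Y_{2m+2} together,
-- in the proportion that removes the contribution of the constant term 1.

module Submission where

open import Defs
open import Algebra.Bundles using (CommutativeRing)
open import Data.Fin.Base as Fin using (Fin; zero; suc; toℕ; punchIn; inject₁; lift)
open import Data.Fin.Properties as Fin using (punchInᵢ≢i; suc-injective)
import Data.Integer.Base as ℤ
import Data.Integer.Properties as ℤ
open import Data.Nat.Base as ℕ using (ℕ; zero; suc; _!; _∸_; _≤_)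
import Data.Nat.Properties as ℕ
open import Data.Nat.Properties using (_!≢0)
open import Data.Nat.Tactic.RingSolver using (solve-∀)
open import Data.Product using (∃; _,_)
open import Data.Rational.Base using (ℚ; 0ℚ; 1ℚ; ½; -_; _*_; _+_; _-_; _/_; fromℚᵘ)
open import Data.Rational.Properties
open import Data.Rational.Solver
import Data.Rational.Unnormalised.Base as ℚᵘ
import Data.Rational.Unnormalised.Properties as ℚᵘ
open import Data.Vec.Functional using (updateAt)
open import Data.Vec.Functional.Properties using (updateAt-updates; updateAt-minimal; updateAt-id-local)
open import Function.Base using (_∘_)
open import Relation.Binary.PropositionalEquality hiding (J)

open import Algebra.Properties.Semiring.Sum (CommutativeRing.semiring +-*-commutativeRing)
  using (sum-cong-≗; sum-replicate-zero; sum-init-last; sum-remove; ∑-comm; ∑-distrib-+;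
         *-distribˡ-sum; *-distribʳ-sum)

open ≡-Reasoning
open +-*-Solver using (solve; _:=_; _:+_; _:*_; :-_; con)

-- Determinants

sum-zero : ∀ {n} {f : Fin n → ℚ} → (∀ i → f i ≡ 0ℚ) → sum f ≡ 0ℚ
sum-zero {n} f≡0 = trans (sum-cong-≗ f≡0) (sum-replicate-zero n)

det-cong : ∀ {n} {A B : Matrix n} → (∀ r c → A r c ≡ B r c) → det A ≡ det B
det-cong {zero}  A≡B = refl
det-cong {suc n} A≡B = sum-cong-≗ λ j →
  cong₂ (λ x d → (- 1ℚ) ^ toℕ j * x * d) (A≡B zero j)
        (det-cong λ r c → A≡B (suc r) (punchIn j c))

-- Induction on the row: row zero enters the expansion linearly, a lower row enters every minor
-- linearly. The `B i` are constrained by equations instead of being built by row replacement, so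
-- that their minors satisfy the same hypotheses.
det-row-linear : ∀ {n k} (p : Fin n) (A : Matrix n) (v : Fin k → ℚ) (B : Fin k → Matrix n) →
  (∀ i {r} → r ≢ p → B i r ≡ A r) → (∀ c → A p c ≡ sum λ i → v i * B i p c) →
  det A ≡ sum λ i → v i * det (B i)
det-row-linear {suc n} zero A v B off on = begin
  (sum λ j → (- 1ℚ) ^ toℕ j * A zero j * minor A j)
    ≡⟨ sum-cong-≗ (λ j → cong (λ x → (- 1ℚ) ^ toℕ j * x * minor A j) (on j)) ⟩
  (sum λ j → (- 1ℚ) ^ toℕ j * (sum λ i → v i * B i zero j) * minor A j)
    ≡⟨ sum-cong-≗ (λ j → trans (cong (_* minor A j) (*-distribˡ-sum ((- 1ℚ) ^ toℕ j) λ i → v i * B i zero j))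
                               (*-distribʳ-sum (minor A j) λ i → (- 1ℚ) ^ toℕ j * (v i * B i zero j))) ⟩
  (sum λ j → sum λ i → (- 1ℚ) ^ toℕ j * (v i * B i zero j) * minor A j)
    ≡⟨ ∑-comm (λ j i → (- 1ℚ) ^ toℕ j * (v i * B i zero j) * minor A j) ⟩
  (sum λ i → sum λ j → (- 1ℚ) ^ toℕ j * (v i * B i zero j) * minor A j)
    ≡⟨ sum-cong-≗ (λ i → trans (sum-cong-≗ λ j → term i j)
        (sym (*-distribˡ-sum (v i) λ j → (- 1ℚ) ^ toℕ j * B i zero j * minor (B i) j))) ⟩
  (sum λ i → v i * det (B i)) ∎
  where
  minor : Matrix (suc n) → Fin (suc n) → ℚ
  minor C j = det λ r c → C (suc r) (punchIn j c)
  term : ∀ i j → (- 1ℚ) ^ toℕ j * (v i * B i zero j) * minor A j ≡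
                 v i * ((- 1ℚ) ^ toℕ j * B i zero j * minor (B i) j)
  term i j = trans
    (cong ((- 1ℚ) ^ toℕ j * (v i * B i zero j) *_)
      (det-cong λ r c → sym (cong (λ row → row (punchIn j c)) (off i λ ()))))
    (solve 4 (λ s x y m → s :* (x :* y) :* m := x :* (s :* y :* m)) refl
      ((- 1ℚ) ^ toℕ j) (v i) (B i zero j) (minor (B i) j))
det-row-linear {suc n} (suc p) A v B off on = begin
  (sum λ j → s j * A zero j * minor A j)
    ≡⟨ sum-cong-≗ (λ j → cong (s j * A zero j *_)
        (det-row-linear p _ v (λ i r c → B i (suc r) (punchIn j c))
          (λ i r≢p → cong (_∘ punchIn j) (off i (r≢p ∘ suc-injective)))
          (λ c → on (punchIn j c)))) ⟩
  (sum λ j → s j * A zero j * (sum λ i → v i * minor (B i) j))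
    ≡⟨ sum-cong-≗ (λ j → *-distribˡ-sum (s j * A zero j) λ i → v i * minor (B i) j) ⟩
  (sum λ j → sum λ i → s j * A zero j * (v i * minor (B i) j))
    ≡⟨ ∑-comm (λ j i → s j * A zero j * (v i * minor (B i) j)) ⟩
  (sum λ i → sum λ j → s j * A zero j * (v i * minor (B i) j))
    ≡⟨ sum-cong-≗ (λ i → trans (sum-cong-≗ λ j → term i j)
        (sym (*-distribˡ-sum (v i) λ j → s j * B i zero j * minor (B i) j))) ⟩
  (sum λ i → v i * det (B i)) ∎
  where
  s : Fin (suc n) → ℚ
  s j = (- 1ℚ) ^ toℕ j
  minor : Matrix (suc n) → Fin (suc n) → ℚ
  minor C j = det λ r c → C (suc r) (punchIn j c)
  term : ∀ i j → s j * A zero j * (v i * minor (B i) j) ≡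
                 v i * (s j * B i zero j * minor (B i) j)
  term i j = trans
    (cong (λ row → s j * row j * (v i * minor (B i) j)) (sym (off i λ ())))
    (solve 4 (λ s x y m → s :* y :* (x :* m) := x :* (s :* y :* m)) refl
      (s j) (v i) (B i zero j) (minor (B i) j))

-- The Laplace expansion along two rows x and y, with the complementary minor
-- abstracted to a function of the map that selects its columns.
laplace₂ : ∀ {n} (x y : Fin (suc (suc n)) → ℚ) (minor : (Fin n → Fin (suc (suc n))) → ℚ) → ℚ
laplace₂ x y minor = sum λ j → (- 1ℚ) ^ toℕ j * x j *
  (sum λ k → (- 1ℚ) ^ toℕ k * y (punchIn j k) * minor (punchIn j ∘ punchIn k))

punchIn-lift : ∀ {n} (j : Fin (suc (suc n))) (k : Fin (suc n)) (c : Fin (suc n)) →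
  punchIn (suc j) (punchIn (suc k) c) ≡ lift 1 (punchIn j ∘ punchIn k) c
punchIn-lift j k zero    = refl
punchIn-lift j k (suc c) = refl

module _ {n} (x y : Fin (suc (suc n)) → ℚ) (minor : (Fin n → Fin (suc (suc n))) → ℚ) where

  border : (Fin (suc (suc n)) → ℚ) → ℚ
  border z = sum λ k → (- 1ℚ) ^ toℕ k * z (suc k) * minor (suc ∘ punchIn k)

  inner : ℚ
  inner = sum λ j → (- 1ℚ) ^ toℕ j * x (suc j) *
    (sum λ k → (- 1ℚ) ^ toℕ k * y (suc (punchIn j k)) * minor (punchIn (suc j) ∘ punchIn (suc k)))

  -- The terms are sorted by which row takes column 0: `x`, `y` or neither. When `y` takes it, the
  -- column of `x` lies one place further right, hence the opposite sign.
  laplace₂-split : laplace₂ x y minor ≡ x zero * border y + (- (y zero * border x) + inner)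
  laplace₂-split = cong₂ _+_ (cong (_* border y) (*-identityˡ (x zero))) (begin
    (sum λ j → - 1ℚ * s j * x (suc j) * (1ℚ * y zero * m j + (sum λ k → - 1ℚ * s k * Y j k * M j k)))
      ≡⟨ sum-cong-≗ (λ j → trans
          (cong (λ z → - 1ℚ * s j * x (suc j) * (1ℚ * y zero * m j + z))
            (trans (sum-cong-≗ λ k → solve 3 (λ s y m → :- con 1ℚ :* s :* y :* m := :- con 1ℚ :* (s :* y :* m)) refl (s k) (Y j k) (M j k))
                   (sym (*-distribˡ-sum (- 1ℚ) λ k → s k * Y j k * M j k))))
          (solve 5 (λ s x y m z → :- con 1ℚ :* s :* x :* (con 1ℚ :* y :* m :+ :- con 1ℚ :* z) :=
                                  :- y :* (s :* x :* m) :+ s :* x :* z) refl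
            (s j) (x (suc j)) (y zero) (m j) (sum λ k → s k * Y j k * M j k))) ⟩
    (sum λ j → - y zero * (s j * x (suc j) * m j) + s j * x (suc j) * (sum λ k → s k * Y j k * M j k))
      ≡⟨ ∑-distrib-+ (λ j → - y zero * (s j * x (suc j) * m j))
           (λ j → s j * x (suc j) * (sum λ k → s k * Y j k * M j k)) ⟩
    (sum λ j → - y zero * (s j * x (suc j) * m j)) + inner
      ≡⟨ cong (_+ inner) (trans (sym (*-distribˡ-sum (- y zero) λ j → s j * x (suc j) * m j))
                                (sym (neg-distribˡ-* (y zero) (border x)))) ⟩
    - (y zero * border x) + inner ∎)
    where
    s : ∀ {k} → Fin k → ℚ
    s k = (- 1ℚ) ^ toℕ k
    Y : Fin (suc n) → Fin n → ℚ
    Y j k = y (suc (punchIn j k))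
    m : Fin (suc n) → ℚ
    m j = minor (suc ∘ punchIn j)
    M : Fin (suc n) → Fin n → ℚ
    M j k = minor (punchIn (suc j) ∘ punchIn (suc k))

-- The border terms cancel when the rows are exchanged, and `inner` is the same expansion over the
-- columns after the first, so induction on `n` applies. The column maps involved agree only
-- pointwise, hence the congruence hypothesis on `minor`.
laplace₂-antisym : ∀ {n} (x y : Fin (suc (suc n)) → ℚ) (minor : (Fin n → Fin (suc (suc n))) → ℚ) →
  (∀ {σ τ} → σ ≗ τ → minor σ ≡ minor τ) →
  laplace₂ x y minor + laplace₂ y x minor ≡ 0ℚ
laplace₂-antisym {n} x y minor minor-cong = begin
  laplace₂ x y minor + laplace₂ y x minor
    ≡⟨ cong₂ _+_ (laplace₂-split x y minor) (laplace₂-split y x minor) ⟩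
  (x zero * border x y minor y + (- (y zero * border x y minor x) + inner x y minor)) +
  (y zero * border x y minor x + (- (x zero * border x y minor y) + inner y x minor))
    ≡⟨ solve 4 (λ p q i j → (p :+ (:- q :+ i)) :+ (q :+ (:- p :+ j)) := i :+ j) refl
        (x zero * border x y minor y) (y zero * border x y minor x) (inner x y minor) (inner y x minor) ⟩
  inner x y minor + inner y x minor
    ≡⟨ inner-antisym x y minor minor-cong ⟩
  0ℚ ∎
  where
  inner-antisym : ∀ {n} (x y : Fin (suc (suc n)) → ℚ) (minor : (Fin n → Fin (suc (suc n))) → ℚ) →
    (∀ {σ τ} → σ ≗ τ → minor σ ≡ minor τ) → inner x y minor + inner y x minor ≡ 0ℚ
  inner-antisym {zero} x y minor minor-cong =
    solve 2 (λ x y → (con 1ℚ :* x :* con 0ℚ :+ con 0ℚ) :+ (con 1ℚ :* y :* con 0ℚ :+ con 0ℚ) := con 0ℚ)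
      refl (x (suc zero)) (y (suc zero))
  inner-antisym {suc n} x y minor minor-cong = trans
    (cong₂ _+_ (inner≡laplace₂ x y) (inner≡laplace₂ y x))
    (laplace₂-antisym (x ∘ suc) (y ∘ suc) (minor ∘ lift 1) λ σ≗τ → minor-cong
      λ { zero → refl ; (suc c) → cong suc (σ≗τ c) })
    where
    inner≡laplace₂ : ∀ x y → inner x y minor ≡ laplace₂ (x ∘ suc) (y ∘ suc) (minor ∘ lift 1)
    inner≡laplace₂ x y = sum-cong-≗ λ j → cong ((- 1ℚ) ^ toℕ j * x (suc j) *_)
      (sum-cong-≗ λ k → cong ((- 1ℚ) ^ toℕ k * y (suc (punchIn j k)) *_)
        (minor-cong (punchIn-lift j k)))

x+x≡0⇒x≡0 : ∀ {x} → x + x ≡ 0ℚ → x ≡ 0ℚ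
x+x≡0⇒x≡0 {x} x+x≡0 = begin
  x            ≡⟨ solve 1 (λ x → x := con ½ :* (x :+ x)) refl x ⟩
  ½ * (x + x)  ≡⟨ cong (½ *_) x+x≡0 ⟩
  ½ * 0ℚ       ≡⟨⟩
  0ℚ           ∎

-- Antisymmetry with equal rows says that twice the determinant is 0.
det-rows₀₁-equal : ∀ {n} (A : Matrix (suc (suc n))) → A zero ≗ A (suc zero) → det A ≡ 0ℚ
det-rows₀₁-equal {n} A eq = x+x≡0⇒x≡0 (trans (cong₂ _+_ det≡ det≡)
  (laplace₂-antisym (A zero) (A zero) minor λ σ≗τ → det-cong λ r c → cong (A (suc (suc r))) (σ≗τ c)))
  where
  minor : (Fin n → Fin (suc (suc n))) → ℚ
  minor σ = det λ r c → A (suc (suc r)) (σ c)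
  det≡ : det A ≡ laplace₂ (A zero) (A zero) minor
  det≡ = sum-cong-≗ λ j → cong ((- 1ℚ) ^ toℕ j * A zero j *_)
    (sum-cong-≗ λ k → cong (λ z → (- 1ℚ) ^ toℕ k * z * minor (punchIn j ∘ punchIn k)) (sym (eq (punchIn j k))))

swap₀₁ : ∀ {n} → Matrix (suc (suc n)) → Matrix (suc (suc n))
swap₀₁ A zero          = A (suc zero)
swap₀₁ A (suc zero)    = A zero
swap₀₁ A (suc (suc r)) = A (suc (suc r))

det-swap₀₁ : ∀ {n} (A : Matrix (suc (suc n))) → det A + det (swap₀₁ A) ≡ 0ℚ
det-swap₀₁ A = laplace₂-antisym (A zero) (A (suc zero)) (λ σ → det λ r c → A (suc (suc r)) (σ c))
  λ σ≗τ → det-cong λ r c → cong (A (suc (suc r))) (σ≗τ c)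

-- Expansion along row 0 settles two equal rows below it. If row 0 equals a row beyond row 1,
-- exchanging rows 0 and 1 moves the repetition below row 0 and only changes the sign.
det-rows-equal : ∀ {n} (A : Matrix n) (p q : Fin n) → p Fin.< q → A p ≗ A q → det A ≡ 0ℚ
det-row-repeated : ∀ {n} (A : Matrix (suc n)) (p q : Fin n) → p Fin.< q →
  A (suc p) ≗ A (suc q) → det A ≡ 0ℚ
det-row-repeated A p q p<q eq = sum-zero λ j →
  trans (cong ((- 1ℚ) ^ toℕ j * A zero j *_) (det-rows-equal _ p q p<q (eq ∘ punchIn j)))
        (*-zeroʳ ((- 1ℚ) ^ toℕ j * A zero j))
det-rows-equal A zero    (suc zero)    _ eq = det-rows₀₁-equal A eq
det-rows-equal A zero    (suc (suc q)) _ eq = begin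
  det A                   ≡⟨ +-identityʳ (det A) ⟨
  det A + 0ℚ              ≡⟨ cong (det A +_) (det-row-repeated (swap₀₁ A) zero (suc q) (ℕ.s≤s ℕ.z≤n) eq) ⟨
  det A + det (swap₀₁ A)  ≡⟨ det-swap₀₁ A ⟩
  0ℚ                      ∎
det-rows-equal A (suc p) (suc q) (ℕ.s≤s p<q) eq = det-row-repeated A p q p<q eq

-- As `det` expands along the first row, this goes by induction on the size. A minor that drops an
-- earlier column has a last row of the same shape; the minor that drops the last column has a zero
-- last row.
det-last-row : ∀ {n} (A : Matrix (suc n)) → (∀ c → A (Fin.fromℕ n) (inject₁ c) ≡ 0ℚ) →
  det A ≡ A (Fin.fromℕ n) (Fin.fromℕ n) * det (λ r c → A (inject₁ r) (inject₁ c))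
det-last-row {zero}  A _      = trans (+-identityʳ _) (cong (_* 1ℚ) (*-identityˡ (A zero zero)))
det-last-row {suc n} A last≡0 = begin
  det A
    ≡⟨ sum-init-last (λ j → s j * A zero j * minor j) ⟩
  (sum λ j → s (inject₁ j) * A zero (inject₁ j) * minor (inject₁ j)) + s ℓ * A zero ℓ * minor ℓ
    ≡⟨ cong₂ _+_ (sum-cong-≗ head-term) last-term ⟩
  (sum λ j → A ℓ ℓ * (s j * A zero (inject₁ j) * det (λ r c → A (suc (inject₁ r)) (inject₁ (punchIn j c))))) + 0ℚ
    ≡⟨ trans (+-identityʳ _) (sym (*-distribˡ-sum (A ℓ ℓ) λ j →
        s j * A zero (inject₁ j) * det (λ r c → A (suc (inject₁ r)) (inject₁ (punchIn j c))))) ⟩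
  A ℓ ℓ * det (λ r c → A (inject₁ r) (inject₁ c)) ∎
  where
  ℓ : Fin (suc (suc n))
  ℓ = Fin.fromℕ (suc n)
  s : ∀ {k} → Fin k → ℚ
  s j = (- 1ℚ) ^ toℕ j
  minor : Fin (suc (suc n)) → ℚ
  minor j = det λ r c → A (suc r) (punchIn j c)
  punchIn-inject₁ : ∀ {n} (j : Fin (suc n)) c → punchIn (inject₁ j) (inject₁ c) ≡ inject₁ (punchIn j c)
  punchIn-inject₁ zero    c       = refl
  punchIn-inject₁ (suc j) zero    = refl
  punchIn-inject₁ (suc j) (suc c) = cong suc (punchIn-inject₁ j c)
  punchIn-inject₁-last : ∀ {n} (j : Fin (suc n)) → punchIn (inject₁ j) (Fin.fromℕ n) ≡ Fin.fromℕ (suc n)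
  punchIn-inject₁-last zero                = refl
  punchIn-inject₁-last {suc n} (suc j)     = cong suc (punchIn-inject₁-last j)
  punchIn-last : ∀ {n} (c : Fin n) → punchIn (Fin.fromℕ n) c ≡ inject₁ c
  punchIn-last zero    = refl
  punchIn-last (suc c) = cong suc (punchIn-last c)
  head-term : ∀ j → s (inject₁ j) * A zero (inject₁ j) * minor (inject₁ j) ≡
    A ℓ ℓ * (s j * A zero (inject₁ j) * det (λ r c → A (suc (inject₁ r)) (inject₁ (punchIn j c))))
  head-term j = begin
    s (inject₁ j) * A zero (inject₁ j) * minor (inject₁ j)
      ≡⟨ cong₂ (λ i m → (- 1ℚ) ^ i * A zero (inject₁ j) * m) (Fin.toℕ-inject₁ j)
          (det-last-row (λ r c → A (suc r) (punchIn (inject₁ j) c))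
            λ c → trans (cong (A ℓ) (punchIn-inject₁ j c)) (last≡0 (punchIn j c))) ⟩
    s j * A zero (inject₁ j) * (A ℓ (punchIn (inject₁ j) (Fin.fromℕ n)) * det (λ r c → A (suc (inject₁ r)) (punchIn (inject₁ j) (inject₁ c))))
      ≡⟨ cong₂ (λ i d → s j * A zero (inject₁ j) * (A ℓ i * d)) (punchIn-inject₁-last j)
          (det-cong λ r c → cong (A (suc (inject₁ r))) (punchIn-inject₁ j c)) ⟩
    s j * A zero (inject₁ j) * (A ℓ ℓ * d)
      ≡⟨ solve 4 (λ s a l d → s :* a :* (l :* d) := l :* (s :* a :* d)) refl (s j) (A zero (inject₁ j)) (A ℓ ℓ) d ⟩
    A ℓ ℓ * (s j * A zero (inject₁ j) * d) ∎
    where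
    d : ℚ
    d = det λ r c → A (suc (inject₁ r)) (inject₁ (punchIn j c))
  zero-row : ∀ c → A ℓ (punchIn ℓ c) ≡ 0ℚ
  zero-row c = trans (cong (A ℓ) (punchIn-last c)) (last≡0 c)
  last-term : s ℓ * A zero ℓ * minor ℓ ≡ 0ℚ
  last-term = begin
    s ℓ * A zero ℓ * minor ℓ
      ≡⟨ cong (s ℓ * A zero ℓ *_) (det-last-row (λ r c → A (suc r) (punchIn ℓ c)) (zero-row ∘ inject₁)) ⟩
    s ℓ * A zero ℓ * (A ℓ (punchIn ℓ (Fin.fromℕ n)) * d)
      ≡⟨ cong (λ x → s ℓ * A zero ℓ * (x * d)) (zero-row (Fin.fromℕ n)) ⟩
    s ℓ * A zero ℓ * (0ℚ * d)
      ≡⟨ solve 2 (λ x d → x :* (con 0ℚ :* d) := con 0ℚ) refl (s ℓ * A zero ℓ) d ⟩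
    0ℚ ∎
    where
    d : ℚ
    d = det λ r c → A (suc (inject₁ r)) (punchIn ℓ (inject₁ c))

-- Row replacement and consecutive Hankel determinants

infixl 8 _[_]≔_

_[_]≔_ : ∀ {n} → Matrix n → Fin n → (Fin n → ℚ) → Matrix n
A [ p ]≔ w = updateAt A p λ _ → w

[]≔-updates : ∀ {n} (A : Matrix n) p w → (A [ p ]≔ w) p ≡ w
[]≔-updates A p w = updateAt-updates p A

[]≔-minimal : ∀ {n} (A : Matrix n) p w {r} → r ≢ p → (A [ p ]≔ w) r ≡ A r
[]≔-minimal A p w r≢p = updateAt-minimal _ p A r≢p

-- By linearity the right side is a sum over `i` of `v i` times the determinant with row `i` copied
-- into the last row. A copy of an earlier row gives 0; the copy of the last row itself restores
-- `A`.
det-combine-last-row : ∀ {n} (A : Matrix (suc n)) (v : Fin (suc n) → ℚ) →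
  v (Fin.fromℕ n) * det A ≡ det (A [ Fin.fromℕ n ]≔ λ c → sum λ i → v i * A i c)
det-combine-last-row {n} A v = begin
  v ℓ * det A
    ≡⟨ +-identityʳ _ ⟨
  v ℓ * det A + 0ℚ
    ≡⟨ cong₂ (λ x y → v ℓ * x + y)
        (det-cong λ r c → sym (cong (λ row → row c) (updateAt-id-local ℓ A refl r)))
        (sym (sum-zero λ i → trans (cong (v (punchIn ℓ i) *_) (repeated i)) (*-zeroʳ (v (punchIn ℓ i))))) ⟩
  v ℓ * det (B ℓ) + (sum λ i → v (punchIn ℓ i) * det (B (punchIn ℓ i)))
    ≡⟨ sum-remove {i = ℓ} (λ i → v i * det (B i)) ⟨
  (sum λ i → v i * det (B i))
    ≡⟨ det-row-linear ℓ C v B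
        (λ i r≢ℓ → trans ([]≔-minimal A ℓ (A i) r≢ℓ) (sym ([]≔-minimal A ℓ w r≢ℓ)))
        (λ c → trans (cong (λ row → row c) ([]≔-updates A ℓ w))
                     (sum-cong-≗ λ i → cong (λ row → v i * row c) (sym ([]≔-updates A ℓ (A i))))) ⟨
  det C ∎
  where
  ℓ : Fin (suc n)
  ℓ = Fin.fromℕ n
  B : Fin (suc n) → Matrix (suc n)
  B i = A [ ℓ ]≔ A i
  w : Fin (suc n) → ℚ
  w c = sum λ i → v i * A i c
  C : Matrix (suc n)
  C = A [ ℓ ]≔ w
  repeated : ∀ i → det (B (punchIn ℓ i)) ≡ 0ℚ
  repeated i = det-rows-equal (B j) j ℓ
    (Fin.≤∧≢⇒< (Fin.≤fromℕ j) (punchInᵢ≢i ℓ i))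
    λ c → cong (λ row → row c) (trans ([]≔-minimal A ℓ (A j) (punchInᵢ≢i ℓ i)) (sym ([]≔-updates A ℓ (A j))))
    where
    j : Fin (suc n)
    j = punchIn ℓ i

-- The combined last row is zero before its last column, which leaves the corner times the leading
-- minor; for a Hankel matrix this minor is the Hankel determinant of the previous order.
H-combine : ∀ m (u v : ℕ → ℚ) →
  (∀ j → j ℕ.≤ m → sum {suc (suc m)} (λ i → v (toℕ i) * u (toℕ i ℕ.+ j)) ≡ 0ℚ) →
  v (suc m) * H (suc m) u ≡ sum {suc (suc m)} (λ i → v (toℕ i) * u (toℕ i ℕ.+ suc m)) * H m u
H-combine m u v vanish = begin
  v (suc m) * H (suc m) u
    ≡⟨ cong (λ i → v i * H (suc m) u) (Fin.toℕ-fromℕ (suc m)) ⟨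
  v (toℕ ℓ) * H (suc m) u
    ≡⟨ det-combine-last-row A (v ∘ toℕ) ⟩
  det C
    ≡⟨ det-last-row C (λ c → trans (last-row (inject₁ c))
        (vanish (toℕ (inject₁ c)) (subst (ℕ._≤ m) (sym (Fin.toℕ-inject₁ c)) (Fin.toℕ≤pred[n] c)))) ⟩
  C ℓ ℓ * det (λ r c → C (inject₁ r) (inject₁ c))
    ≡⟨ cong₂ _*_ (trans (last-row ℓ) (cong combination (Fin.toℕ-fromℕ (suc m))))
        (det-cong λ r c → trans
          (cong (λ row → row (inject₁ c)) ([]≔-minimal A ℓ w (Fin.fromℕ≢inject₁ ∘ sym)))
          (cong₂ (λ i j → u (i ℕ.+ j)) (Fin.toℕ-inject₁ r) (Fin.toℕ-inject₁ c))) ⟩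
  combination (suc m) * H m u ∎
  where
  ℓ : Fin (suc (suc m))
  ℓ = Fin.fromℕ (suc m)
  combination : ℕ → ℚ
  combination j = sum {suc (suc m)} λ i → v (toℕ i) * u (toℕ i ℕ.+ j)
  A C : Matrix (suc (suc m))
  w : Fin (suc (suc m)) → ℚ
  A i j = u (toℕ i ℕ.+ toℕ j)
  w c = combination (toℕ c)
  C = A [ ℓ ]≔ w
  last-row : ∀ c → C ℓ c ≡ combination (toℕ c)
  last-row c = cong (λ row → row c) ([]≔-updates A ℓ w)

-- Natural numbers and inverse factorials in ℚ

fromℚᵘ-homo-+ : ∀ p q → fromℚᵘ (p ℚᵘ.+ q) ≡ fromℚᵘ p + fromℚᵘ q
fromℚᵘ-homo-+ p q = toℚᵘ-injective (ℚᵘ.≃-trans (toℚᵘ-fromℚᵘ (p ℚᵘ.+ q)) (ℚᵘ.≃-sym (ℚᵘ.≃-trans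
  (toℚᵘ-homo-+ (fromℚᵘ p) (fromℚᵘ q)) (ℚᵘ.+-cong (toℚᵘ-fromℚᵘ p) (toℚᵘ-fromℚᵘ q)))))

fromℚᵘ-homo-* : ∀ p q → fromℚᵘ (p ℚᵘ.* q) ≡ fromℚᵘ p * fromℚᵘ q
fromℚᵘ-homo-* p q = toℚᵘ-injective (ℚᵘ.≃-trans (toℚᵘ-fromℚᵘ (p ℚᵘ.* q)) (ℚᵘ.≃-sym (ℚᵘ.≃-trans
  (toℚᵘ-homo-* (fromℚᵘ p) (fromℚᵘ q)) (ℚᵘ.*-cong (toℚᵘ-fromℚᵘ p) (toℚᵘ-fromℚᵘ q)))))

fromℕ-+ : ∀ m n → fromℕ (m ℕ.+ n) ≡ fromℕ m + fromℕ n
fromℕ-+ m n = trans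
  (cong (_/ 1) (sym (cong₂ ℤ._+_ (ℤ.*-identityʳ (ℤ.+ m)) (ℤ.*-identityʳ (ℤ.+ n)))))
  (fromℚᵘ-homo-+ (ℚᵘ.mkℚᵘ (ℤ.+ m) 0) (ℚᵘ.mkℚᵘ (ℤ.+ n) 0))

fromℕ-* : ∀ m n → fromℕ (m ℕ.* n) ≡ fromℕ m * fromℕ n
fromℕ-* m n = trans (cong (_/ 1) (ℤ.pos-* m n))
  (fromℚᵘ-homo-* (ℚᵘ.mkℚᵘ (ℤ.+ m) 0) (ℚᵘ.mkℚᵘ (ℤ.+ n) 0))

fromℕ-inverseʳ : ∀ n .{{_ : ℕ.NonZero n}} → fromℕ n * (ℤ.+ 1 / n) ≡ 1ℚ
fromℕ-inverseʳ n@(suc k) = trans (sym (fromℚᵘ-homo-* (ℚᵘ.mkℚᵘ (ℤ.+ n) 0) (ℚᵘ.mkℚᵘ (ℤ.+ 1) k)))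
  (fromℚᵘ-cong (ℚᵘ.*-inverseʳ (ℚᵘ.mkℚᵘ (ℤ.+ n) 0)))

/!-* : ∀ q n → q /! n ≡ q * (1ℚ /! n)
/!-* q n = cong (q *_) (sym (*-identityˡ _))

n!/!n : ∀ n → fromℕ (n !) /! n ≡ 1ℚ
n!/!n n = fromℕ-inverseʳ (n !) {{n !≢0}}

fromℕ-suc-! : ∀ n → fromℕ (suc n !) ≡ fromℕ (suc n) * fromℕ (n !)
fromℕ-suc-! n = fromℕ-* (suc n) (n !)

1/!-suc : ∀ n → 1ℚ /! n ≡ fromℕ (suc n) * (1ℚ /! suc n)
1/!-suc n = begin
  1ℚ /! n
    ≡⟨ *-identityʳ (1ℚ /! n) ⟨
  1ℚ /! n * 1ℚ
    ≡⟨ cong (1ℚ /! n *_) (trans (sym (n!/!n (suc n))) (trans (/!-* (fromℕ (suc n !)) (suc n))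
        (cong (_* (1ℚ /! suc n)) (fromℕ-suc-! n)))) ⟩
  1ℚ /! n * (fromℕ (suc n) * fromℕ (n !) * (1ℚ /! suc n))
    ≡⟨ solve 4 (λ x s f y → x :* (s :* f :* y) := f :* x :* (s :* y)) refl
        (1ℚ /! n) (fromℕ (suc n)) (fromℕ (n !)) (1ℚ /! suc n) ⟩
  fromℕ (n !) * (1ℚ /! n) * (fromℕ (suc n) * (1ℚ /! suc n))
    ≡⟨ cong (_* (fromℕ (suc n) * (1ℚ /! suc n))) (trans (sym (/!-* (fromℕ (n !)) n)) (n!/!n n)) ⟩
  1ℚ * (fromℕ (suc n) * (1ℚ /! suc n))
    ≡⟨ *-identityˡ (fromℕ (suc n) * (1ℚ /! suc n)) ⟩
  fromℕ (suc n) * (1ℚ /! suc n) ∎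

fromℕ-suc : ∀ n → fromℕ (suc n) ≡ 1ℚ + fromℕ n
fromℕ-suc = fromℕ-+ 1

-- Power series

shift : Series → Series
shift f zero    = 0ℚ
shift f (suc n) = f n

shift-cong : ∀ {f g : Series} → f ≗ g → shift f ≗ shift g
shift-cong f≗g zero    = refl
shift-cong f≗g (suc n) = f≗g n

⊛-distribʳ-⊕ : ∀ f g h → ((f ⊕ g) ⊛ h) ≗ ((f ⊛ h) ⊕ (g ⊛ h))
⊛-distribʳ-⊕ f g h n = trans
  (sum-cong-≗ {suc n} λ i → *-distribʳ-+ (h (n ∸ toℕ i)) (f (toℕ i)) (g (toℕ i)))
  (∑-distrib-+ {suc n} (λ i → f (toℕ i) * h (n ∸ toℕ i)) (λ i → g (toℕ i) * h (n ∸ toℕ i)))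

·-⊛-assoc : ∀ c f h → ((c · f) ⊛ h) ≗ (c · (f ⊛ h))
·-⊛-assoc c f h n = trans
  (sum-cong-≗ {suc n} λ i → *-assoc c (f (toℕ i)) (h (n ∸ toℕ i)))
  (sym (*-distribˡ-sum {suc n} c λ i → f (toℕ i) * h (n ∸ toℕ i)))

shift-⊛ : ∀ f h → (shift f ⊛ h) ≗ shift (f ⊛ h)
shift-⊛ f h zero    = trans (+-identityʳ _) (*-zeroˡ (h 0))
shift-⊛ f h (suc n) = trans (cong (_+ (f ⊛ h) n) (*-zeroˡ (h (suc n)))) (+-identityˡ _)

⊛-identityˡ : ∀ h → (one ⊛ h) ≗ h
⊛-identityˡ h n = trans
  (cong₂ _+_ (*-identityˡ (h n)) (sum-zero {n} λ i → *-zeroˡ (h (n ∸ suc (toℕ i)))))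
  (+-identityʳ (h n))

-- Since `u` inverts `g 0`, the lowest coefficient of the product forces `f 0` to be 0; then `f` is
-- divided by t and the argument repeats. This carries the order of vanishing from (e^t + 1) Y_N
-- over to Y_N.
⊛-vanish : ∀ g {u} → u * g 0 ≡ 1ℚ → ∀ m f → (∀ n → n ℕ.< m → (f ⊛ g) n ≡ 0ℚ) →
  ∀ n → n ℕ.< m → f n ≡ 0ℚ
⊛-vanish g {u} ug₀≡1 (suc m) f fg≡0 = λ
  { zero _ → f₀≡0
  ; (suc n) (ℕ.s≤s n<m) → ⊛-vanish g {u} ug₀≡1 m (f ∘ suc) tail≡0 n n<m }
  where
  f₀≡0 : f 0 ≡ 0ℚ
  f₀≡0 = begin
    f 0                       ≡⟨ *-identityʳ (f 0) ⟨
    f 0 * 1ℚ                  ≡⟨ cong (f 0 *_) ug₀≡1 ⟨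
    f 0 * (u * g 0)           ≡⟨ solve 3 (λ f u g → f :* (u :* g) := (f :* g :+ con 0ℚ) :* u) refl (f 0) u (g 0) ⟩
    (f 0 * g 0 + 0ℚ) * u      ≡⟨ cong (_* u) (fg≡0 0 ℕ.z<s) ⟩
    0ℚ * u                    ≡⟨ *-zeroˡ u ⟩
    0ℚ                        ∎
  tail≡0 : ∀ n → n ℕ.< m → ((f ∘ suc) ⊛ g) n ≡ 0ℚ
  tail≡0 n n<m = begin
    ((f ∘ suc) ⊛ g) n                      ≡⟨ +-identityˡ _ ⟨
    0ℚ + ((f ∘ suc) ⊛ g) n                 ≡⟨ cong (_+ ((f ∘ suc) ⊛ g) n) (trans (cong (_* g (suc n)) f₀≡0) (*-zeroˡ (g (suc n)))) ⟨
    f 0 * g (suc n) + ((f ∘ suc) ⊛ g) n    ≡⟨ fg≡0 (suc n) (ℕ.s≤s n<m) ⟩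
    0ℚ                                     ∎

shift² : Series → Series
shift² = shift ∘ shift

raise : ℕ → Series → Series
raise zero    f = f
raise (suc N) f = shift² (raise N f)

raise-cong : ∀ N {f g} → f ≗ g → raise N f ≗ raise N g
raise-cong zero    f≗g = f≗g
raise-cong (suc N) f≗g = shift-cong (shift-cong (raise-cong N f≗g))

raise-shift² : ∀ N f → raise N (shift² f) ≗ shift² (raise N f)
raise-shift² zero    f n = refl
raise-shift² (suc N) f   = shift-cong (shift-cong (raise-shift² N f))

raise-⊕-· : ∀ N f c g → raise N (f ⊕ c · g) ≗ (raise N f ⊕ c · raise N g)
raise-⊕-· zero    f c g n             = refl
raise-⊕-· (suc N) f c g zero          = solve 1 (λ c → con 0ℚ := con 0ℚ :+ c :* con 0ℚ) refl c
raise-⊕-· (suc N) f c g (suc zero)    = solve 1 (λ c → con 0ℚ := con 0ℚ :+ c :* con 0ℚ) refl c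
raise-⊕-· (suc N) f c g (suc (suc n)) = raise-⊕-· N f c g n

raise-vanish : ∀ N f n → n ℕ.< N ℕ.* 2 → raise N f n ≡ 0ℚ
raise-vanish (suc N) f zero          _                     = refl
raise-vanish (suc N) f (suc zero)    _                     = refl
raise-vanish (suc N) f (suc (suc n)) (ℕ.s≤s (ℕ.s≤s n<2N)) = raise-vanish N f n n<2N

-- The remainders of the continued fraction of tanh(t/2)

e^t+1 : Series
e^t+1 = exp 1ℚ ⊕ one

-- At x = 1 the Euler generating function is 2e^t/(e^t + 1); subtracting 1 leaves (e^t - 1)/(e^t +
-- 1).
tanh[t/2] : Series
tanh[t/2] = (λ k → E k 1ℚ /! k) ⊕ (- 1ℚ) · one

-- The partial denominators 2, 6, 10, ... of Lambert's continued fraction tanh(t/2) = t/(2 + t²/(6 +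
-- t²/(10 + ...))).
c : ℕ → ℚ
c N = fromℕ (4 ℕ.* N ℕ.+ 2)

Y : ℕ → Series
Y zero          = one
Y (suc zero)    = shift tanh[t/2]
Y (suc (suc N)) = shift² (Y N) ⊕ (- c N) · Y (suc N)

-- (e^t + 1) Y_{N+1} = t^{2N+2} Σₖ r N k tᵏ; up to the factor N! this is
-- t^{2N+2} ∫₀¹ uᴺ (1 − u)ᴺ e^{tu} du, that is, t times the remainder of the Padé
-- approximation of e^t.
r : ℕ → Series
r N k = fromℕ ((N ℕ.+ k) !) * (1ℚ /! k) * (1ℚ /! suc (N ℕ.* 2 ℕ.+ k))

c≡ : ∀ N → c N ≡ fromℕ 4 * fromℕ N + fromℕ 2
c≡ N = trans (fromℕ-+ (4 ℕ.* N) 2) (cong (_+ fromℕ 2) (fromℕ-* 4 N))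

exp1≡ : ∀ n → exp 1ℚ n ≡ 1ℚ /! n
exp1≡ n = cong (_/! n) (1^n≡1 n)
  where
  1^n≡1 : ∀ n → 1ℚ ^ n ≡ 1ℚ
  1^n≡1 zero    = refl
  1^n≡1 (suc n) = trans (*-identityˡ (1ℚ ^ n)) (1^n≡1 n)

r₀≡ : ∀ k → r 0 k ≡ 1ℚ /! suc k
r₀≡ k = trans (cong (_* (1ℚ /! suc k)) (trans (sym (/!-* (fromℕ (k !)) k)) (n!/!n k)))
              (*-identityˡ (1ℚ /! suc k))

r₁≡ : ∀ k → r 1 k ≡ fromℕ (suc k) * (1ℚ /! suc (suc (suc k)))
r₁≡ k = cong (_* (1ℚ /! suc (suc (suc k)))) (begin
  fromℕ (suc k !) * (1ℚ /! k)              ≡⟨ cong (_* (1ℚ /! k)) (fromℕ-suc-! k) ⟩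
  fromℕ (suc k) * fromℕ (k !) * (1ℚ /! k)  ≡⟨ *-assoc (fromℕ (suc k)) (fromℕ (k !)) (1ℚ /! k) ⟩
  fromℕ (suc k) * (fromℕ (k !) * (1ℚ /! k))  ≡⟨ cong (fromℕ (suc k) *_) (trans (sym (/!-* (fromℕ (k !)) k)) (n!/!n k)) ⟩
  fromℕ (suc k) * 1ℚ                       ≡⟨ *-identityʳ (fromℕ (suc k)) ⟩
  fromℕ (suc k)                            ∎)

-- Over the common factor (N+k)!/(k! (2N+k+3)!) the two terms become (2N+k+2)(2N+k+3) and
-- (4N+6)(N+k+1), whose difference is k(k-1).
r-difference : ∀ N k → r N k + (- c (suc N)) * r (suc N) k ≡
  fromℕ k * (fromℕ k - 1ℚ) * (fromℕ ((N ℕ.+ k) !) * (1ℚ /! k) * (1ℚ /! suc (suc N ℕ.* 2 ℕ.+ k)))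
r-difference N k = begin
  F * i * (1ℚ /! suc M) + (- c (suc N)) * (fromℕ (suc (N ℕ.+ k) !) * i * J)
    ≡⟨ cong₂ (λ x y → F * i * x + (- c (suc N)) * (y * i * J))
        (trans (1/!-suc (suc M)) (cong (fromℕ (suc (suc M)) *_) (1/!-suc (suc (suc M)))))
        (fromℕ-suc-! (N ℕ.+ k)) ⟩
  F * i * (fromℕ (2 ℕ.+ M) * (fromℕ (3 ℕ.+ M) * J)) + (- c (suc N)) * (fromℕ (suc (N ℕ.+ k)) * F * i * J)
    ≡⟨ cong₂ (λ x y → F * i * (x * (y * J)) + (- c (suc N)) * (fromℕ (suc (N ℕ.+ k)) * F * i * J))
        (M≡ 2) (M≡ 3) ⟩
  F * i * ((fromℕ 2 + (x * fromℕ 2 + κ)) * ((fromℕ 3 + (x * fromℕ 2 + κ)) * J)) +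
    (- c (suc N)) * (fromℕ (suc (N ℕ.+ k)) * F * i * J)
    ≡⟨ cong₂ (λ y z → F * i * ((fromℕ 2 + (x * fromℕ 2 + κ)) * ((fromℕ 3 + (x * fromℕ 2 + κ)) * J)) +
                       (- y) * (z * F * i * J))
        (trans (c≡ (suc N)) (cong (λ z → fromℕ 4 * z + fromℕ 2) (fromℕ-suc N)))
        (trans (fromℕ-suc (N ℕ.+ k)) (cong (1ℚ +_) (fromℕ-+ N k))) ⟩
  F * i * ((fromℕ 2 + (x * fromℕ 2 + κ)) * ((fromℕ 3 + (x * fromℕ 2 + κ)) * J)) +
    (- (fromℕ 4 * (1ℚ + x) + fromℕ 2)) * ((1ℚ + (x + κ)) * F * i * J)
    ≡⟨ solve 5 (λ F i J x κ →
         F :* i :* ((con (fromℕ 2) :+ (x :* con (fromℕ 2) :+ κ)) :* ((con (fromℕ 3) :+ (x :* con (fromℕ 2) :+ κ)) :* J)) :+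
         (:- (con (fromℕ 4) :* (con 1ℚ :+ x) :+ con (fromℕ 2))) :* ((con 1ℚ :+ (x :+ κ)) :* F :* i :* J) :=
         κ :* (κ :+ :- con 1ℚ) :* (F :* i :* J)) refl F i J x κ ⟩
  κ * (κ - 1ℚ) * (F * i * J) ∎
  where
  M = N ℕ.* 2 ℕ.+ k
  F = fromℕ ((N ℕ.+ k) !)
  i = 1ℚ /! k
  J = 1ℚ /! (3 ℕ.+ M)
  x = fromℕ N
  κ = fromℕ k
  M≡ : ∀ j → fromℕ (j ℕ.+ M) ≡ fromℕ j + (x * fromℕ 2 + κ)
  M≡ j = trans (fromℕ-+ j M) (cong (fromℕ j +_)
    (trans (fromℕ-+ (N ℕ.* 2) k) (cong (_+ κ) (fromℕ-* N 2))))

-- The factor k(k-1) kills degrees 0 and 1 and elsewhere turns 1/k! into 1/(k-2)!, which is the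
-- shift by t².
r-recurrence : ∀ N → (r N ⊕ (- c (suc N)) · r (suc N)) ≗ shift² (r (suc (suc N)))
r-recurrence N zero       = trans (r-difference N 0)
  (*-zeroˡ (fromℕ ((N ℕ.+ 0) !) * (1ℚ /! 0) * (1ℚ /! suc (suc N ℕ.* 2 ℕ.+ 0))))
r-recurrence N (suc zero) = trans (r-difference N 1)
  (*-zeroˡ (fromℕ ((N ℕ.+ 1) !) * (1ℚ /! 1) * (1ℚ /! suc (suc N ℕ.* 2 ℕ.+ 1))))
r-recurrence N (suc (suc k)) = begin
  r N (2 ℕ.+ k) + (- c (suc N)) * r (suc N) (2 ℕ.+ k)
    ≡⟨ r-difference N (2 ℕ.+ k) ⟩
  κ * (κ - 1ℚ) * (fromℕ ((N ℕ.+ (2 ℕ.+ k)) !) * (1ℚ /! (2 ℕ.+ k)) * (1ℚ /! (3 ℕ.+ (N ℕ.* 2 ℕ.+ (2 ℕ.+ k)))))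
    ≡⟨ cong (λ z → κ * z * (fromℕ ((N ℕ.+ (2 ℕ.+ k)) !) * (1ℚ /! (2 ℕ.+ k)) * (1ℚ /! (3 ℕ.+ (N ℕ.* 2 ℕ.+ (2 ℕ.+ k))))))
        (trans (cong (_- 1ℚ) (fromℕ-suc (suc k))) (solve 1 (λ x → con 1ℚ :+ x :+ :- con 1ℚ := x) refl (fromℕ (suc k)))) ⟩
  κ * fromℕ (suc k) * (fromℕ ((N ℕ.+ (2 ℕ.+ k)) !) * (1ℚ /! (2 ℕ.+ k)) * (1ℚ /! (3 ℕ.+ (N ℕ.* 2 ℕ.+ (2 ℕ.+ k)))))
    ≡⟨ cong₂ (λ m n → κ * fromℕ (suc k) * (fromℕ (m !) * (1ℚ /! (2 ℕ.+ k)) * (1ℚ /! (3 ℕ.+ n))))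
        (+-2 N) (+-2 (N ℕ.* 2)) ⟩
  κ * fromℕ (suc k) * (fromℕ ((2 ℕ.+ N ℕ.+ k) !) * (1ℚ /! (2 ℕ.+ k)) * J)
    ≡⟨ solve 5 (λ κ s F i J → κ :* s :* (F :* i :* J) := F :* (s :* (κ :* i)) :* J) refl
        κ (fromℕ (suc k)) (fromℕ ((2 ℕ.+ N ℕ.+ k) !)) (1ℚ /! (2 ℕ.+ k)) J ⟩
  fromℕ ((2 ℕ.+ N ℕ.+ k) !) * (fromℕ (suc k) * (κ * (1ℚ /! (2 ℕ.+ k)))) * J
    ≡⟨ cong (λ z → fromℕ ((2 ℕ.+ N ℕ.+ k) !) * z * J)
        (trans (cong (fromℕ (suc k) *_) (sym (1/!-suc (suc k)))) (sym (1/!-suc k))) ⟩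
  r (2 ℕ.+ N) k ∎
  where
  κ = fromℕ (2 ℕ.+ k)
  J = 1ℚ /! (5 ℕ.+ (N ℕ.* 2 ℕ.+ k))
  +-2 : ∀ n → n ℕ.+ (2 ℕ.+ k) ≡ 2 ℕ.+ (n ℕ.+ k)
  +-2 n = trans (ℕ.+-suc n (suc k)) (cong suc (ℕ.+-suc n k))

-- Both sides are e^t - 1: the left one as 2e^t - (e^t + 1), the right one because `r 0` is (e^t -
-- 1)/t.
tanh-⊛ : (tanh[t/2] ⊛ e^t+1) ≗ shift (r 0)
tanh-⊛ n = trans (⊛-distribʳ-⊕ (λ k → E k 1ℚ /! k) ((- 1ℚ) · one) e^t+1 n) (trans
  (cong₂ _+_ (trans (E-generating 1ℚ n) (cong (fromℕ 2 *_) (exp1≡ n)))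
    (trans (·-⊛-assoc (- 1ℚ) one e^t+1 n)
      (cong (- 1ℚ *_) (trans (⊛-identityˡ e^t+1 n) (cong (_+ one n) (exp1≡ n))))))
  (collect n))
  where
  collect : ∀ n → fromℕ 2 * (1ℚ /! n) + - 1ℚ * (1ℚ /! n + one n) ≡ shift (r 0) n
  collect zero    = refl
  collect (suc k) = trans
    (solve 1 (λ x → con (fromℕ 2) :* x :+ con (- 1ℚ) :* (x :+ con 0ℚ) := x) refl (1ℚ /! suc k))
    (sym (r₀≡ k))

-- The closed form r has no analogue for Y₀, hence a second base case.
Y₂-base : (e^t+1 ⊕ (- c 0) · r 0) ≗ shift² (r 1)
Y₂-base zero       = refl
Y₂-base (suc zero) = refl
Y₂-base (suc (suc k)) = begin
  exp 1ℚ (2 ℕ.+ k) + 0ℚ + (- fromℕ 2) * r 0 (2 ℕ.+ k)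
    ≡⟨ cong₂ (λ x y → x + 0ℚ + (- fromℕ 2) * y) (trans (exp1≡ (2 ℕ.+ k)) (1/!-suc (2 ℕ.+ k))) (r₀≡ (2 ℕ.+ k)) ⟩
  fromℕ (3 ℕ.+ k) * J + 0ℚ + (- fromℕ 2) * J
    ≡⟨ cong (λ x → x * J + 0ℚ + (- fromℕ 2) * J) (fromℕ-+ 2 (suc k)) ⟩
  (fromℕ 2 + fromℕ (suc k)) * J + 0ℚ + (- fromℕ 2) * J
    ≡⟨ solve 2 (λ x J → (con (fromℕ 2) :+ x) :* J :+ con 0ℚ :+ con (- fromℕ 2) :* J := x :* J) refl (fromℕ (suc k)) J ⟩
  fromℕ (suc k) * J
    ≡⟨ r₁≡ k ⟨
  r 1 k ∎
  where
  J = 1ℚ /! (3 ℕ.+ k)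

shift²-⊛ : ∀ f h → (shift² f ⊛ h) ≗ shift² (f ⊛ h)
shift²-⊛ f h n = trans (shift-⊛ (shift f) h n) (shift-cong (shift-⊛ f h) n)

-- Multiplied by e^t + 1, the recurrence of `Y` shows a common factor t^{2N+2} (`Y-step`); the
-- missing t² comes from `Y₂-base` or `r-recurrence`.
Y-⊛ : ∀ N → (Y (suc N) ⊛ e^t+1) ≗ raise (suc N) (r N)
Y-step : ∀ N f g → (Y N ⊛ e^t+1) ≗ raise N f → (Y (suc N) ⊛ e^t+1) ≗ raise (suc N) g →
  (Y (2 ℕ.+ N) ⊛ e^t+1) ≗ raise (suc N) (f ⊕ (- c N) · g)
Y-step N f g eq eq′ n = trans (⊛-distribʳ-⊕ (shift² (Y N)) ((- c N) · Y (suc N)) e^t+1 n) (trans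
  (cong₂ _+_ (trans (shift²-⊛ (Y N) e^t+1 n) (shift-cong (shift-cong eq) n))
    (trans (·-⊛-assoc (- c N) (Y (suc N)) e^t+1 n) (cong (- c N *_) (eq′ n))))
  (sym (raise-⊕-· (suc N) f (- c N) g n)))
Y-⊛ zero n = trans (shift-⊛ tanh[t/2] e^t+1 n) (shift-cong tanh-⊛ n)
Y-⊛ (suc zero) n = trans
  (Y-step 0 e^t+1 (r 0) (⊛-identityˡ e^t+1) (Y-⊛ 0) n)
  (raise-cong 1 Y₂-base n)
Y-⊛ (suc (suc N)) n = trans
  (Y-step (suc N) (r N) (r (suc N)) (Y-⊛ N) (Y-⊛ (suc N)) n)
  (trans (raise-cong (2 ℕ.+ N) (r-recurrence N) n) (raise-shift² (2 ℕ.+ N) (r (2 ℕ.+ N)) n))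

Y-vanish : ∀ N n → n ℕ.< N ℕ.* 2 → Y N n ≡ 0ℚ
-- `½` inverts the constant coefficient 2 of e^t + 1.
Y-vanish (suc N) = ⊛-vanish e^t+1 {½} refl (suc N ℕ.* 2) (Y (suc N)) λ n n<2N →
  trans (Y-⊛ N n) (raise-vanish (suc N) (r N) n n<2N)

-- Hankel determinants

-- The coefficients in t². With `k ℕ.* 2`, a successor of `k` reduces to two successors, so the
-- recurrence of `Y` holds for `y` by computation.
y : ℕ → Series
y N k = Y N (k ℕ.* 2)

y-vanish : ∀ N k → k ℕ.< N → y N k ≡ 0ℚ
y-vanish N k k<N = Y-vanish N (k ℕ.* 2) (ℕ.*-monoˡ-< 2 k<N)

y₀≡ : ∀ k → y 0 k ≡ one k
y₀≡ zero    = refl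
y₀≡ (suc k) = refl

2k+1≡ : ∀ k → 1 ℕ.+ k ℕ.* 2 ≡ 2 ℕ.* suc k ∸ 1
2k+1≡ k = lemma k
  where
  lemma : ∀ k → 1 ℕ.+ k ℕ.* 2 ≡ k ℕ.+ suc (k ℕ.+ 0)
  lemma = solve-∀

y₁≡ : ∀ k → y 1 k ≡ b k
y₁≡ zero    = refl
y₁≡ (suc k) = trans (+-identityʳ _) (cong (λ n → E n 1ℚ /! n) (2k+1≡ k))

a : ℕ → ℚ
a k = b (suc k)

a≡ : ∀ k → E (2 ℕ.* k ℕ.+ 1) 1ℚ /! (2 ℕ.* k ℕ.+ 1) ≡ a k
a≡ k = cong (λ n → E n 1ℚ /! n) (trans (lemma k) (2k+1≡ k))
  where
  lemma : ∀ k → 2 ℕ.* k ℕ.+ 1 ≡ 1 ℕ.+ k ℕ.* 2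
  lemma = solve-∀

-- The coefficient of t^{2N+2} in Y_{N+2} lies below its order 2N+4, so the two terms of the
-- recurrence cancel there.
y-diagonal : ∀ N → y N N ≡ c N * y (suc N) (suc N)
y-diagonal N = begin
  y N N
    ≡⟨ solve 2 (λ x z → x := x :+ :- z :+ z) refl (y N N) z ⟩
  y N N + (- z) + z
    ≡⟨ cong (λ w → y N N + w + z) (neg-distribˡ-* (c N) (y (suc N) (suc N))) ⟩
  y (2 ℕ.+ N) (suc N) + z
    ≡⟨ cong (_+ z) (y-vanish (2 ℕ.+ N) (suc N) ℕ.≤-refl) ⟩
  0ℚ + z
    ≡⟨ +-identityˡ z ⟩
  z ∎
  where
  z = c N * y (suc N) (suc N)

-- The coefficient of t^{2(m+j)} in the product of the series `u` in t² with the polynomial in t² of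
-- degree `m` whose coefficients, from the top, are `v`.
comb : ℕ → (ℕ → ℚ) → (ℕ → ℚ) → ℕ → ℚ
comb m v u j = sum {suc m} λ i → v (toℕ i) * u (toℕ i ℕ.+ j)

comb-⊕-· : ∀ m f s g u j → comb m (f ⊕ s · g) u j ≡ comb m f u j + s * comb m g u j
comb-⊕-· m f s g u j = begin
  comb m (f ⊕ s · g) u j
    ≡⟨ sum-cong-≗ {suc m} (λ i → solve 4 (λ f s g u → (f :+ s :* g) :* u := f :* u :+ s :* (g :* u)) refl
        (f (toℕ i)) s (g (toℕ i)) (u (toℕ i ℕ.+ j))) ⟩
  sum {suc m} (λ i → f (toℕ i) * u (toℕ i ℕ.+ j) + s * (g (toℕ i) * u (toℕ i ℕ.+ j)))
    ≡⟨ ∑-distrib-+ {suc m} (λ i → f (toℕ i) * u (toℕ i ℕ.+ j)) (λ i → s * (g (toℕ i) * u (toℕ i ℕ.+ j))) ⟩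
  comb m f u j + sum {suc m} (λ i → s * (g (toℕ i) * u (toℕ i ℕ.+ j)))
    ≡⟨ cong (comb m f u j +_) (*-distribˡ-sum {suc m} s λ i → g (toℕ i) * u (toℕ i ℕ.+ j)) ⟨
  comb m f u j + s * comb m g u j ∎

-- Read from the top, a polynomial keeps its coefficients when multiplied by t², whereas regarding
-- it as one of higher degree shifts them. This lemma and `comb-shift` cover these two cases in the
-- recurrence.
comb-extend : ∀ m v u j → v (suc m) ≡ 0ℚ → comb (suc m) v u j ≡ comb m v u j
comb-extend m v u j v≡0 = trans (sum-init-last {suc m} λ i → v (toℕ i) * u (toℕ i ℕ.+ j)) (trans
  (cong₂ _+_
    (sum-cong-≗ {suc m} λ i → cong (λ k → v k * u (k ℕ.+ j)) (Fin.toℕ-inject₁ i))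
    (trans (cong (_* u (toℕ (Fin.fromℕ (suc m)) ℕ.+ j)) (trans (cong v (Fin.toℕ-fromℕ (suc m))) v≡0))
      (*-zeroˡ (u (toℕ (Fin.fromℕ (suc m)) ℕ.+ j)))))
  (+-identityʳ (comb m v u j)))

comb-shift : ∀ m v u j → comb (suc m) (shift v) u j ≡ comb m v (u ∘ suc) j
comb-shift m v u j = trans (cong (_+ comb m v (u ∘ suc) j) (*-zeroˡ (u j))) (+-identityˡ _)

comb-suc : ∀ m v u j → comb m v (u ∘ suc) j ≡ comb m v u (suc j)
comb-suc m v u j = sum-cong-≗ {suc m} λ i → cong (λ k → v (toℕ i) * u k) (sym (ℕ.+-suc (toℕ i) j))

-- The coefficients, as polynomials in t² of degree m read from the top, with which
-- t T enters Y_{2m+1} and Y_{2m+2}.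
P Q : ℕ → Series
P zero    = one
P (suc m) = P m ⊕ (- c (1 ℕ.+ m ℕ.* 2)) · shift (Q m)
Q zero    = (- fromℕ 2) · one
Q (suc m) = Q m ⊕ (- c (2 ℕ.+ m ℕ.* 2)) · P (suc m)

x+s*0≡0 : ∀ {x z} s → x ≡ 0ℚ → z ≡ 0ℚ → x + s * z ≡ 0ℚ
x+s*0≡0 s refl refl = trans (+-identityˡ (s * 0ℚ)) (*-zeroʳ s)

P-degree : ∀ m i → m ℕ.< i → P m i ≡ 0ℚ
Q-degree : ∀ m i → m ℕ.< i → Q m i ≡ 0ℚ
P-degree zero    (suc i) _           = refl
P-degree (suc m) (suc i) (ℕ.s≤s m<i) =
  x+s*0≡0 (- c (1 ℕ.+ m ℕ.* 2)) (P-degree m (suc i) (ℕ.m<n⇒m<1+n m<i)) (Q-degree m i m<i)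
Q-degree zero    (suc i) _           = refl
Q-degree (suc m) (suc i) m<i         =
  x+s*0≡0 (- c (2 ℕ.+ m ℕ.* 2)) (Q-degree m (suc i) (ℕ.<-trans ℕ.≤-refl m<i)) (P-degree (suc m) (suc i) m<i)

-- The contribution of the constant term 1 to Y_{2m+1}, in degree 2m, is − e m.
e : ℕ → ℚ
e zero    = 0ℚ
e (suc m) = e m + c (1 ℕ.+ m ℕ.* 2)

-- The part of Y_N free of T is a polynomial in t², with t^{2m}-term - `e m` as its top for Y_{2m+1}
-- and top term t^{2m+2} for Y_{2m+2}. From that degree on it is felt only at `j` = 0, through
-- `one j`. The recurrence of `Y` proves both claims together.
odd-combination  : ∀ m j → comb m (P m) b j ≡ y (1 ℕ.+ m ℕ.* 2) (m ℕ.+ j) + e m * one j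
even-combination : ∀ m j → comb m (Q m) a j + one j ≡ y (2 ℕ.+ m ℕ.* 2) (suc (m ℕ.+ j))
odd-combination zero j = trans
  (cong (λ z → 1ℚ * z + 0ℚ) (sym (y₁≡ j)))
  (solve 2 (λ x o → con 1ℚ :* x :+ con 0ℚ := x :+ con 0ℚ :* o) refl (y 1 j) (one j))
odd-combination (suc m) j = begin
  comb (suc m) (P (suc m)) b j
    ≡⟨ comb-⊕-· (suc m) (P m) (- C) (shift (Q m)) b j ⟩
  comb (suc m) (P m) b j + (- C) * comb (suc m) (shift (Q m)) b j
    ≡⟨ cong₂ (λ x z → x + (- C) * z)
        (trans (comb-extend m (P m) b j (P-degree m (suc m) ℕ.≤-refl)) (odd-combination m j))
        (comb-shift m (Q m) b j) ⟩
  y₁ + e m * one j + (- C) * comb m (Q m) a j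
    ≡⟨ solve 5 (λ y e o C q → y :+ e :* o :+ :- C :* q := y :+ :- C :* (q :+ o) :+ (e :+ C) :* o) refl
        y₁ (e m) (one j) C (comb m (Q m) a j) ⟩
  y₁ + (- C) * (comb m (Q m) a j + one j) + e (suc m) * one j
    ≡⟨ cong (λ z → y₁ + (- C) * z + e (suc m) * one j) (even-combination m j) ⟩
  y (1 ℕ.+ suc m ℕ.* 2) (suc m ℕ.+ j) + e (suc m) * one j ∎
  where
  C  = c (1 ℕ.+ m ℕ.* 2)
  y₁ = y (1 ℕ.+ m ℕ.* 2) (m ℕ.+ j)
even-combination zero j = begin
  (- fromℕ 2) * 1ℚ * a j + 0ℚ + one j
    ≡⟨ solve 2 (λ x o → con (- fromℕ 2) :* con 1ℚ :* x :+ con 0ℚ :+ o := o :+ con (- fromℕ 2) :* x) refl (a j) (one j) ⟩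
  one j + (- fromℕ 2) * a j
    ≡⟨ cong₂ (λ o x → o + (- fromℕ 2) * x) (sym (y₀≡ j)) (sym (y₁≡ (suc j))) ⟩
  y 2 (suc j) ∎
even-combination (suc m) j = begin
  comb (suc m) (Q (suc m)) a j + one j
    ≡⟨ cong (_+ one j) (comb-⊕-· (suc m) (Q m) (- C) (P (suc m)) a j) ⟩
  comb (suc m) (Q m) a j + (- C) * comb (suc m) (P (suc m)) a j + one j
    ≡⟨ cong₂ (λ x z → x + (- C) * z + one j)
        (comb-extend m (Q m) a j (Q-degree m (suc m) ℕ.≤-refl))
        (trans (comb-suc (suc m) (P (suc m)) b j) (odd-combination (suc m) (suc j))) ⟩
  comb m (Q m) a j + (- C) * (y₃ (suc m ℕ.+ suc j) + e (suc m) * 0ℚ) + one j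
    ≡⟨ cong (λ k → comb m (Q m) a j + (- C) * (y₃ k + e (suc m) * 0ℚ) + one j) (ℕ.+-suc (suc m) j) ⟩
  comb m (Q m) a j + (- C) * (y₃ (2 ℕ.+ m ℕ.+ j) + e (suc m) * 0ℚ) + one j
    ≡⟨ solve 5 (λ q C y e o → q :+ :- C :* (y :+ e :* con 0ℚ) :+ o := q :+ o :+ :- C :* y) refl
        (comb m (Q m) a j) C (y₃ (2 ℕ.+ m ℕ.+ j)) (e (suc m)) (one j) ⟩
  comb m (Q m) a j + one j + (- C) * y₃ (2 ℕ.+ m ℕ.+ j)
    ≡⟨ cong (_+ (- C) * y₃ (2 ℕ.+ m ℕ.+ j)) (even-combination m j) ⟩
  y (2 ℕ.+ suc m ℕ.* 2) (suc (suc m ℕ.+ j)) ∎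
  where
  C  = c (2 ℕ.+ m ℕ.* 2)
  y₃ = y (3 ℕ.+ m ℕ.* 2)

-- Recursions for the two Hankel determinants

m+m≡m*2 : ∀ m → m ℕ.+ m ≡ m ℕ.* 2
m+m≡m*2 m = trans (cong (m ℕ.+_) (sym (ℕ.+-identityʳ m))) (ℕ.*-comm 2 m)

m+j≤m*2 : ∀ m {j} → j ℕ.≤ m → m ℕ.+ j ℕ.≤ m ℕ.* 2
m+j≤m*2 m {j} j≤m = subst (m ℕ.+ j ℕ.≤_) (m+m≡m*2 m) (ℕ.+-monoʳ-≤ m j≤m)

-- The first coefficient of Y_{2m+3}, at t^{4m+6}, that the order of vanishing leaves open. Both
-- recursions contain it, so it is eliminated between them.
leading : ℕ → ℚ
leading m = y (3 ℕ.+ m ℕ.* 2) (3 ℕ.+ m ℕ.* 2)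

-- The vector is `P (suc m)`. As `a` is `b` without its first term, `odd-combination` is read at
-- `suc j`, where the contribution of the constant term 1 has gone.
H-a-step : ∀ m → (- c (1 ℕ.+ m ℕ.* 2)) * Q m m * H (suc m) a ≡ leading m * H m a
H-a-step m = begin
  (- C) * Q m m * H (suc m) a
    ≡⟨ cong (_* H (suc m) a) (trans (sym (+-identityˡ ((- C) * Q m m))) (cong (_+ (- C) * Q m m) (sym (P-degree m (suc m) ℕ.≤-refl)))) ⟩
  P (suc m) (suc m) * H (suc m) a
    ≡⟨ H-combine m a (P (suc m)) (λ j j≤m → trans (comb≡y j) (y-vanish (3 ℕ.+ m ℕ.* 2) (suc m ℕ.+ suc j)
        (subst (ℕ._< 3 ℕ.+ m ℕ.* 2) (sym (ℕ.+-suc (suc m) j)) (ℕ.s≤s (ℕ.s≤s (ℕ.s≤s (m+j≤m*2 m j≤m))))))) ⟩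
  comb (suc m) (P (suc m)) a (suc m) * H m a
    ≡⟨ cong (_* H m a) (trans (comb≡y (suc m)) (cong (y (3 ℕ.+ m ℕ.* 2))
        (trans (ℕ.+-suc (suc m) (suc m)) (cong suc (m+m≡m*2 (suc m)))))) ⟩
  leading m * H m a ∎
  where
  C = c (1 ℕ.+ m ℕ.* 2)
  comb≡y : ∀ j → comb (suc m) (P (suc m)) a j ≡ y (3 ℕ.+ m ℕ.* 2) (suc m ℕ.+ suc j)
  comb≡y j = trans (comb-suc (suc m) (P (suc m)) b j) (trans (odd-combination (suc m) (suc j))
    (trans (cong (y (3 ℕ.+ m ℕ.* 2) (suc m ℕ.+ suc j) +_) (*-zeroʳ (e (suc m)))) (+-identityʳ _)))

-- The weight `e (suc m)` in `v` makes the `one j` terms of the odd and even combinations cancel.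
-- The last entry of `v` is then (`e (suc m)` - c_{2m+1}) `Q m m`, that is, `e m * Q m m`.
H-b-step : ∀ m → e m * Q m m * H (suc m) b ≡ e (suc m) * (c (2 ℕ.+ m ℕ.* 2) * leading m) * H m b
H-b-step m = begin
  e m * Q m m * H (suc m) b
    ≡⟨ cong (_* H (suc m) b) (trans
        (solve 3 (λ e q C → e :* q := con 0ℚ :+ :- C :* q :+ (e :+ C) :* q) refl (e m) (Q m m) C)
        (cong (λ z → z + (- C) * Q m m + e (suc m) * Q m m) (sym (P-degree m (suc m) ℕ.≤-refl)))) ⟩
  v (suc m) * H (suc m) b
    ≡⟨ H-combine m b v (λ j j≤m → trans (comb≡y j) (x+s*0≡0 (e (suc m))
        (y-vanish (3 ℕ.+ m ℕ.* 2) (suc m ℕ.+ j) (ℕ.s≤s (ℕ.m≤n⇒m≤1+n (ℕ.s≤s (m+j≤m*2 m j≤m)))))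
        (y-vanish (2 ℕ.+ m ℕ.* 2) (suc (m ℕ.+ j)) (ℕ.s≤s (ℕ.s≤s (m+j≤m*2 m j≤m)))))) ⟩
  comb (suc m) v b (suc m) * H m b
    ≡⟨ cong (_* H m b) (trans (comb≡y (suc m)) (trans
        (cong₂ (λ x z → x + e (suc m) * z)
          -- In the corner Y_{2m+3} is read at t^{4m+4}, still below its order, so only Y_{2m+2}
          -- contributes.
          (y-vanish (3 ℕ.+ m ℕ.* 2) (suc m ℕ.+ suc m) (ℕ.s≤s (m+j≤m*2 (suc m) ℕ.≤-refl)))
          (trans (cong (y (2 ℕ.+ m ℕ.* 2)) (m+m≡m*2 (suc m))) (y-diagonal (2 ℕ.+ m ℕ.* 2))))
        (+-identityˡ (e (suc m) * (c (2 ℕ.+ m ℕ.* 2) * leading m))))) ⟩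
  e (suc m) * (c (2 ℕ.+ m ℕ.* 2) * leading m) * H m b ∎
  where
  C = c (1 ℕ.+ m ℕ.* 2)
  v : Series
  v = P (suc m) ⊕ e (suc m) · shift (Q m)
  comb≡y : ∀ j → comb (suc m) v b j ≡
    y (3 ℕ.+ m ℕ.* 2) (suc m ℕ.+ j) + e (suc m) * y (2 ℕ.+ m ℕ.* 2) (suc (m ℕ.+ j))
  comb≡y j = begin
    comb (suc m) v b j
      ≡⟨ comb-⊕-· (suc m) (P (suc m)) (e (suc m)) (shift (Q m)) b j ⟩
    comb (suc m) (P (suc m)) b j + e (suc m) * comb (suc m) (shift (Q m)) b j
      ≡⟨ cong₂ (λ x z → x + e (suc m) * z) (odd-combination (suc m) j) (comb-shift m (Q m) b j) ⟩
    y (3 ℕ.+ m ℕ.* 2) (suc m ℕ.+ j) + e (suc m) * one j + e (suc m) * comb m (Q m) a j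
      ≡⟨ solve 4 (λ y e o q → y :+ e :* o :+ e :* q := y :+ e :* (q :+ o)) refl
          (y (3 ℕ.+ m ℕ.* 2) (suc m ℕ.+ j)) (e (suc m)) (one j) (comb m (Q m) a j) ⟩
    y (3 ℕ.+ m ℕ.* 2) (suc m ℕ.+ j) + e (suc m) * (comb m (Q m) a j + one j)
      ≡⟨ cong (λ z → y (3 ℕ.+ m ℕ.* 2) (suc m ℕ.+ j) + e (suc m) * z) (even-combination m j) ⟩
    y (3 ℕ.+ m ℕ.* 2) (suc m ℕ.+ j) + e (suc m) * y (2 ℕ.+ m ℕ.* 2) (suc (m ℕ.+ j)) ∎

-- The sum telescopes: c_{2m+1} = 8m + 6 = (2m+2)(2m+3) - 2m(2m+1).
e≡ : ∀ m → e m ≡ fromℕ (m ℕ.* 2) * fromℕ (suc (m ℕ.* 2))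
e≡ zero    = refl
e≡ (suc m) = begin
  e m + c (1 ℕ.+ m ℕ.* 2)
    ≡⟨ cong₂ _+_ (e≡ m) (c≡ (1 ℕ.+ m ℕ.* 2)) ⟩
  fromℕ (m ℕ.* 2) * fromℕ (1 ℕ.+ m ℕ.* 2) + (fromℕ 4 * fromℕ (1 ℕ.+ m ℕ.* 2) + fromℕ 2)
    ≡⟨ cong (λ z → x * z + (fromℕ 4 * z + fromℕ 2)) (fromℕ-+ 1 (m ℕ.* 2)) ⟩
  x * (fromℕ 1 + x) + (fromℕ 4 * (fromℕ 1 + x) + fromℕ 2)
    ≡⟨ solve 1 (λ x → x :* (con (fromℕ 1) :+ x) :+ (con (fromℕ 4) :* (con (fromℕ 1) :+ x) :+ con (fromℕ 2)) :=
                      (con (fromℕ 2) :+ x) :* (con (fromℕ 3) :+ x)) refl x ⟩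
  (fromℕ 2 + x) * (fromℕ 3 + x)
    ≡⟨ cong₂ _*_ (fromℕ-+ 2 (m ℕ.* 2)) (fromℕ-+ 3 (m ℕ.* 2)) ⟨
  fromℕ (2 ℕ.+ m ℕ.* 2) * fromℕ (3 ℕ.+ m ℕ.* 2) ∎
  where
  x = fromℕ (m ℕ.* 2)

-- Invertible factors and the constant of the theorem

Invertible : ℚ → Set
Invertible x = ∃ λ z → z * x ≡ 1ℚ

*-invertible : ∀ {x z} → Invertible x → Invertible z → Invertible (x * z)
*-invertible {x} {z} (x⁻¹ , x⁻¹x≡1) (z⁻¹ , z⁻¹z≡1) = x⁻¹ * z⁻¹ , (begin
  x⁻¹ * z⁻¹ * (x * z)    ≡⟨ solve 4 (λ x x′ z z′ → x′ :* z′ :* (x :* z) := x′ :* x :* (z′ :* z)) refl x x⁻¹ z z⁻¹ ⟩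
  x⁻¹ * x * (z⁻¹ * z)    ≡⟨ cong₂ _*_ x⁻¹x≡1 z⁻¹z≡1 ⟩
  1ℚ                     ∎)

neg-invertible : ∀ {x} → Invertible x → Invertible (- x)
neg-invertible {x} (x⁻¹ , x⁻¹x≡1) = - x⁻¹ , trans (solve 2 (λ x z → :- z :* :- x := z :* x) refl x x⁻¹) x⁻¹x≡1

fromℕ-invertible : ∀ n .{{_ : ℕ.NonZero n}} → Invertible (fromℕ n)
fromℕ-invertible n = ℤ.+ 1 / n , trans (*-comm (ℤ.+ 1 / n) (fromℕ n)) (fromℕ-inverseʳ n)

*-cancelˡ : ∀ {s x z} → Invertible s → s * x ≡ s * z → x ≡ z
*-cancelˡ {s} {x} {z} (s⁻¹ , s⁻¹s≡1) sx≡sz = begin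
  x               ≡⟨ *-identityˡ x ⟨
  1ℚ * x          ≡⟨ cong (_* x) s⁻¹s≡1 ⟨
  s⁻¹ * s * x     ≡⟨ *-assoc s⁻¹ s x ⟩
  s⁻¹ * (s * x)   ≡⟨ cong (s⁻¹ *_) sx≡sz ⟩
  s⁻¹ * (s * z)   ≡⟨ *-assoc s⁻¹ s z ⟨
  s⁻¹ * s * z     ≡⟨ cong (_* z) s⁻¹s≡1 ⟩
  1ℚ * z          ≡⟨ *-identityˡ z ⟩
  z               ∎

-c-invertible : ∀ N → Invertible (- c N)
-c-invertible N = neg-invertible (subst (Invertible ∘ fromℕ) (ℕ.+-comm 2 (4 ℕ.* N))
  (fromℕ-invertible (2 ℕ.+ 4 ℕ.* N)))

-- The degree bounds leave a single product in the recurrence for the last coefficient, so it is a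
-- product of values of `- c` and the initial -2.
Q-leading-invertible : ∀ m → Invertible (Q m m)
Q-leading-invertible zero    = - ½ , refl
Q-leading-invertible (suc m) = subst Invertible (sym Q≡)
  (*-invertible (-c-invertible (2 ℕ.+ m ℕ.* 2)) (*-invertible (-c-invertible (1 ℕ.+ m ℕ.* 2)) (Q-leading-invertible m)))
  where
  Q≡ : Q (suc m) (suc m) ≡ (- c (2 ℕ.+ m ℕ.* 2)) * ((- c (1 ℕ.+ m ℕ.* 2)) * Q m m)
  Q≡ = trans
    (cong₂ (λ q p → q + (- c (2 ℕ.+ m ℕ.* 2)) * (p + (- c (1 ℕ.+ m ℕ.* 2)) * Q m m))
      (Q-degree m (suc m) ℕ.≤-refl) (P-degree m (suc m) ℕ.≤-refl))
    (solve 2 (λ s t → con 0ℚ :+ s :* (con 0ℚ :+ t) := s :* t) refl (- c (2 ℕ.+ m ℕ.* 2)) ((- c (1 ℕ.+ m ℕ.* 2)) * Q m m))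

e-invertible : ∀ m → Invertible (e (suc m))
e-invertible m = subst Invertible (sym (e≡ (suc m)))
  (*-invertible (fromℕ-invertible (2 ℕ.+ m ℕ.* 2)) (fromℕ-invertible (3 ℕ.+ m ℕ.* 2)))

-- The factor in the theorem for n = k + 1.
K : ℕ → ℚ
K k = (- 1ℚ) ^ suc k * (fromℕ ((6 ℕ.+ k ℕ.* 4) !) /! suc (k ℕ.* 2))

-- The quotient of consecutive constants is -(4k+10)(4k+9)(4k+8)(4k+7)/((2k+2)(2k+3)). Here
-- (2k+2)(2k+3) is `e (suc k)`, and the numerator regroups as (2k+4)(2k+5) times (8k+18)(8k+14).
K-step : ∀ k → e (suc k) * K (suc k) ≡ - (e (2 ℕ.+ k) * (c (4 ℕ.+ k ℕ.* 2) * c (3 ℕ.+ k ℕ.* 2)) * K k)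
K-step k = begin
  e (suc k) * (- 1ℚ * s * (fromℕ ((10 ℕ.+ k ℕ.* 4) !) /! (3 ℕ.+ k ℕ.* 2)))
    ≡⟨ cong₂ (λ x z → x * (- 1ℚ * s * z)) (e≡ (suc k))
        (trans (/!-* (fromℕ ((10 ℕ.+ k ℕ.* 4) !)) (3 ℕ.+ k ℕ.* 2)) (cong (_* J) factorial)) ⟩
  n 2 * n 3 * (- 1ℚ * s * (f 10 * f 9 * (f 8 * f 7) * F * J))
    ≡⟨ solve 6 (λ n₂ n₃ s f F J → n₂ :* n₃ :* (con (- 1ℚ) :* s :* (f :* F :* J)) :=
                                  :- (f :* (s :* (F :* (n₂ :* (n₃ :* J)))))) refl
        (n 2) (n 3) s (f 10 * f 9 * (f 8 * f 7)) F J ⟩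
  - (f 10 * f 9 * (f 8 * f 7) * (s * (F * (n 2 * (n 3 * J)))))
    ≡⟨ cong₂ (λ x z → - (x * (s * (F * z)))) polynomial
        (sym (trans (1/!-suc (1 ℕ.+ k ℕ.* 2)) (cong (n 2 *_) (1/!-suc (2 ℕ.+ k ℕ.* 2))))) ⟩
  - (e (2 ℕ.+ k) * (c (4 ℕ.+ k ℕ.* 2) * c (3 ℕ.+ k ℕ.* 2)) * (s * (F * (1ℚ /! suc (k ℕ.* 2)))))
    ≡⟨ cong (λ z → - (e (2 ℕ.+ k) * (c (4 ℕ.+ k ℕ.* 2) * c (3 ℕ.+ k ℕ.* 2)) * (s * z))) (/!-* F (suc (k ℕ.* 2))) ⟨
  - (e (2 ℕ.+ k) * (c (4 ℕ.+ k ℕ.* 2) * c (3 ℕ.+ k ℕ.* 2)) * K k) ∎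
  where
  s F J x : ℚ
  s = (- 1ℚ) ^ suc k
  F = fromℕ ((6 ℕ.+ k ℕ.* 4) !)
  J = 1ℚ /! (3 ℕ.+ k ℕ.* 2)
  x = fromℕ k
  n f : ℕ → ℚ
  n j = fromℕ (j ℕ.+ k ℕ.* 2)
  f j = fromℕ (j ℕ.+ k ℕ.* 4)
  n≡ : ∀ j → n j ≡ fromℕ j + x * fromℕ 2
  n≡ j = trans (fromℕ-+ j (k ℕ.* 2)) (cong (fromℕ j +_) (fromℕ-* k 2))
  f≡ : ∀ j → f j ≡ fromℕ j + x * fromℕ 4
  f≡ j = trans (fromℕ-+ j (k ℕ.* 4)) (cong (fromℕ j +_) (fromℕ-* k 4))
  c-n : ∀ j → c (j ℕ.+ k ℕ.* 2) ≡ fromℕ 4 * (fromℕ j + x * fromℕ 2) + fromℕ 2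
  c-n j = trans (c≡ (j ℕ.+ k ℕ.* 2)) (cong (λ z → fromℕ 4 * z + fromℕ 2) (n≡ j))
  factorial : fromℕ ((10 ℕ.+ k ℕ.* 4) !) ≡ f 10 * f 9 * (f 8 * f 7) * F
  factorial = begin
    fromℕ ((10 ℕ.+ k ℕ.* 4) !)
      ≡⟨ fromℕ-suc-! (9 ℕ.+ k ℕ.* 4) ⟩
    f 10 * fromℕ ((9 ℕ.+ k ℕ.* 4) !)
      ≡⟨ cong (f 10 *_) (fromℕ-suc-! (8 ℕ.+ k ℕ.* 4)) ⟩
    f 10 * (f 9 * fromℕ ((8 ℕ.+ k ℕ.* 4) !))
      ≡⟨ cong (λ z → f 10 * (f 9 * z)) (fromℕ-suc-! (7 ℕ.+ k ℕ.* 4)) ⟩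
    f 10 * (f 9 * (f 8 * fromℕ ((7 ℕ.+ k ℕ.* 4) !)))
      ≡⟨ cong (λ z → f 10 * (f 9 * (f 8 * z))) (fromℕ-suc-! (6 ℕ.+ k ℕ.* 4)) ⟩
    f 10 * (f 9 * (f 8 * (f 7 * F)))
      ≡⟨ solve 5 (λ a b c d F → a :* (b :* (c :* (d :* F))) := a :* b :* (c :* d) :* F) refl (f 10) (f 9) (f 8) (f 7) F ⟩
    f 10 * f 9 * (f 8 * f 7) * F ∎
  polynomial : f 10 * f 9 * (f 8 * f 7) ≡ e (2 ℕ.+ k) * (c (4 ℕ.+ k ℕ.* 2) * c (3 ℕ.+ k ℕ.* 2))
  polynomial = begin
    f 10 * f 9 * (f 8 * f 7)
      ≡⟨ cong₂ _*_ (cong₂ _*_ (f≡ 10) (f≡ 9)) (cong₂ _*_ (f≡ 8) (f≡ 7)) ⟩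
    (fromℕ 10 + x * fromℕ 4) * (fromℕ 9 + x * fromℕ 4) * ((fromℕ 8 + x * fromℕ 4) * (fromℕ 7 + x * fromℕ 4))
      ≡⟨ solve 1 (λ x →
          (con (fromℕ 10) :+ x :* con (fromℕ 4)) :* (con (fromℕ 9) :+ x :* con (fromℕ 4)) :*
            ((con (fromℕ 8) :+ x :* con (fromℕ 4)) :* (con (fromℕ 7) :+ x :* con (fromℕ 4))) :=
          (con (fromℕ 4) :+ x :* con (fromℕ 2)) :* (con (fromℕ 5) :+ x :* con (fromℕ 2)) :*
            ((con (fromℕ 4) :* (con (fromℕ 4) :+ x :* con (fromℕ 2)) :+ con (fromℕ 2)) :*
             (con (fromℕ 4) :* (con (fromℕ 3) :+ x :* con (fromℕ 2)) :+ con (fromℕ 2)))) refl x ⟩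
    (fromℕ 4 + x * fromℕ 2) * (fromℕ 5 + x * fromℕ 2) *
      ((fromℕ 4 * (fromℕ 4 + x * fromℕ 2) + fromℕ 2) * (fromℕ 4 * (fromℕ 3 + x * fromℕ 2) + fromℕ 2))
      ≡⟨ cong₂ _*_ (trans (e≡ (2 ℕ.+ k)) (cong₂ _*_ (n≡ 4) (n≡ 5))) (cong₂ _*_ (c-n 4) (c-n 3)) ⟨
    e (2 ℕ.+ k) * (c (4 ℕ.+ k ℕ.* 2) * c (3 ℕ.+ k ℕ.* 2)) ∎

H-b≡K*H-a : ∀ k → H (suc k) b ≡ K k * H (suc k) a
-- Since `e 0` is 0, the factor in `H-b-step` cannot be cancelled at `m` = 0; the induction
-- therefore starts at order 1, where both sides are evaluated.
H-b≡K*H-a zero    = refl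
H-b≡K*H-a (suc k) = *-cancelˡ (*-invertible (e-invertible k) (Q-leading-invertible (suc k))) (begin
  e m * q * H (suc m) b
    ≡⟨ H-b-step m ⟩
  e (suc m) * (c₂ * leading m) * H m b
    ≡⟨ cong (e (suc m) * (c₂ * leading m) *_) (H-b≡K*H-a k) ⟩
  e (suc m) * (c₂ * leading m) * (K k * H m a)
    ≡⟨ solve 5 (λ e c l K h → e :* (c :* l) :* (K :* h) := e :* c :* K :* (l :* h)) refl
        (e (suc m)) c₂ (leading m) (K k) (H m a) ⟩
  e (suc m) * c₂ * K k * (leading m * H m a)
    -- Read backwards, the recursion for `a` absorbs `leading m`.
    ≡⟨ cong (e (suc m) * c₂ * K k *_) (H-a-step m) ⟨
  e (suc m) * c₂ * K k * ((- c₁) * q * H (suc m) a)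
    ≡⟨ solve 6 (λ e c d K q h → e :* c :* K :* (:- d :* q :* h) := :- (e :* (c :* d) :* K) :* (q :* h)) refl
        (e (suc m)) c₂ c₁ (K k) q (H (suc m) a) ⟩
  - (e (suc m) * (c₂ * c₁) * K k) * (q * H (suc m) a)
    ≡⟨ cong (_* (q * H (suc m) a)) (K-step k) ⟨
  e m * K m * (q * H (suc m) a)
    ≡⟨ solve 4 (λ e K q h → e :* K :* (q :* h) := e :* q :* (K :* h)) refl (e m) (K m) q (H (suc m) a) ⟩
  e m * q * (K m * H (suc m) a) ∎)
  where
  m : ℕ
  m = suc k
  q c₁ c₂ : ℚ
  q = Q m m
  c₁ = c (1 ℕ.+ m ℕ.* 2)
  c₂ = c (2 ℕ.+ m ℕ.* 2)

proposition6p3 : (n : ℕ) → 1 ≤ n →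
    H n b ≡ (- 1ℚ) ^ n * (fromℕ ((4 ℕ.* n ℕ.+ 2) !) /! (2 ℕ.* n ∸ 1)) * H n (λ k → E (2 ℕ.* k ℕ.+ 1) 1ℚ /! (2 ℕ.* k ℕ.+ 1))
proposition6p3 (suc k) _ = trans (H-b≡K*H-a k) (cong₂ _*_
  (cong₂ (λ m n → (- 1ℚ) ^ suc k * (fromℕ (m !) /! n))
    (lemma k) (2k+1≡ k))
  (det-cong {suc (suc k)} λ i j → sym (a≡ (toℕ i ℕ.+ toℕ j))))
  where
  lemma : ∀ k → 6 ℕ.+ k ℕ.* 4 ≡ 4 ℕ.* suc k ℕ.+ 2
  lemma = solve-∀
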